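{- Let $G$ be a block graph with diameter $2$. Then $G$ is $\chi_\rho$-critical if and only if $\delta(G) \geq 2$.
   Context: Graphs are finite and simple. A block of $G$ is a maximal connected subgraph without cut vertices; a block graph is a connected graph in which every block is a complete graph. $\delta(G)$ is the minimum degree. A $k$-packing coloring of $G$ is a map $c:V(G)\to\{1,\ldots,k\}$ such that two distinct vertices $u,v$ with $c(u)=c(v)=i$ satisfy $d_G(u,v)>i$ (distance between vertices in different components is infinite); $\chi_\rho(G)$ is the smallest $k$ for which such a coloring exists. $G$ is $\chi_\rho$-critical if $\chi_\rho(H)<\chi_\rho(G)$ for every proper subgraph $H$ of $G$. -}

module Defs where

open import Data.Fin.Base using (Fin; toℕ; fromℕ<; finToFun; funToFin)
import Data.Fin.Properties as Fin
open import Data.List.Base using (List; map; filter; length; allFin)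
open import Data.List.Extrema.Nat using (min)
open import Data.Nat.Base using (ℕ; zero; suc; _≤_; _<_; _^_; _⊓_; z≤n; s≤s)
open import Data.Nat.Properties using (_≤?_; _≟_; allUpTo?; suc-injective; m≤n⇒m⊓n≡m; m⊓n≤n; ≰⇒>; <⇒≱; <-≤-trans)
open import Data.Product.Base using (∃; ∃-syntax; _×_; _,_; proj₁; proj₂)
open import Function.Base using (_∘_)
open import Level using (0ℓ)
open import Relation.Binary.Core using (Rel)
import Relation.Binary.Definitions as B
open import Relation.Binary.PropositionalEquality using (_≡_; _≢_; refl; sym; trans; cong; subst)
open import Relation.Nullary using (¬_; yes; no; contradiction)
open import Relation.Nullary.Decidable using (map′; _×-dec_; _→-dec_; ¬?)
open import Relation.Unary using (Pred; _∈_; _⊆_; Decidable)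

-- Finite simple graphs whose vertex set is an arbitrary subset V of the
-- ambient set Fin n.  Every finite simple graph is of this form up to
-- isomorphism, and the subgraphs of G : Graph n are again of type Graph n.
record Graph (n : ℕ) : Set₁ where
  field
    V       : Pred (Fin n) 0ℓ
    Adj     : Rel (Fin n) 0ℓ
    V?      : Decidable V
    Adj?    : B.Decidable Adj
    Adj-sym : ∀ {u v} → Adj u v → Adj v u
    irrefl  : ∀ {v} → ¬ Adj v v
    Adj⇒V   : ∀ {u v} → Adj u v → u ∈ V

open Graph public

module _ {n : ℕ} where

  infix 4 _⊑_ _⊏_

  _⊑_ : Graph n → Graph n → Set
  H ⊑ G = V H ⊆ V G × (∀ {u v} → Adj H u v → Adj G u v)

  _⊏_ : Graph n → Graph n → Set
  H ⊏ G = H ⊑ G × ¬ (G ⊑ H)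

  deleteVertex : Graph n → Fin n → Graph n
  deleteVertex G x = record
    { V       = λ v → v ∈ V G × v ≢ x
    ; Adj     = λ u v → Adj G u v × u ≢ x × v ≢ x
    ; V?      = λ v → V? G v ×-dec ¬? (v Fin.≟ x)
    ; Adj?    = λ u v → Adj? G u v ×-dec ¬? (u Fin.≟ x) ×-dec ¬? (v Fin.≟ x)
    ; Adj-sym = λ (a , p , q) → Adj-sym G a , q , p
    ; irrefl  = λ (a , _) → irrefl G a
    ; Adj⇒V   = λ (a , p , _) → Adj⇒V G a , p
    }

  data Walk (G : Graph n) : Fin n → Fin n → ℕ → Set where
    nil  : ∀ {v} → v ∈ V G → Walk G v v 0
    cons : ∀ {u w v k} → Adj G u w → Walk G w v k → Walk G u v (suc k)

  Joined : Graph n → Fin n → Fin n → Set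
  Joined G u v = ∃[ k ] Walk G u v k

  Connected : Graph n → Set
  Connected G = ∃ (V G) × (∀ {u v} → u ∈ V G → v ∈ V G → Joined G u v)

  -- x separates two other vertices lying in the same component of G.
  CutVertex : Graph n → Fin n → Set
  CutVertex G x = x ∈ V G × ∃[ u ] ∃[ v ]
    (u ≢ x × v ≢ x × Joined G u v × ¬ Joined (deleteVertex G x) u v)

  NoCutVertex : Graph n → Set
  NoCutVertex G = ∀ x → ¬ CutVertex G x

  IsBlock : Graph n → Graph n → Set₁
  IsBlock G B = B ⊑ G × Connected B × NoCutVertex B ×
    (∀ B′ → B ⊑ B′ → B′ ⊑ G → Connected B′ → NoCutVertex B′ → B′ ⊑ B)

  Complete : Graph n → Set
  Complete G = ∀ {u v} → u ∈ V G → v ∈ V G → u ≢ v → Adj G u v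

  BlockGraph : Graph n → Set₁
  BlockGraph G = Connected G × (∀ B → IsBlock G B → Complete B)

Least : Pred ℕ 0ℓ → Pred ℕ 0ℓ
Least P k = P k × (∀ {j} → P j → k ≤ j)

least : ∀ {P} → Decidable P → ∀ m → P m → ∃ (Least P)
least P? zero p = zero , p , λ _ → z≤n
least {P} P? (suc m) p with P? 0
... | yes p₀ = zero , p₀ , λ _ → z≤n
... | no ¬p₀ with k , pk , k≤ ← least {P ∘ suc} (P? ∘ suc) m p =
  suc k , pk , λ { {zero} q → contradiction q ¬p₀ ; {suc j} q → s≤s (k≤ q) }

module _ {n : ℕ} where

  IsDistance : Graph n → Fin n → Fin n → ℕ → Set
  IsDistance G u v = Least (Walk G u v)

  -- d(u,v) > i.  Vertices in different components have no finite distance,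
  -- so for them this holds for every i.
  DistanceExceeds : Graph n → Fin n → Fin n → ℕ → Set
  DistanceExceeds G u v i = ∀ {d} → IsDistance G u v d → i < d

  HasDiameter : Graph n → ℕ → Set
  HasDiameter G D =
    (∀ {u v} → u ∈ V G → v ∈ V G → ∃[ d ] (IsDistance G u v d × d ≤ D)) ×
    (∃[ u ] ∃[ v ] (u ∈ V G × v ∈ V G × IsDistance G u v D))

  degree : Graph n → Fin n → ℕ
  degree G v = length (filter (Adj? G v) (allFin n))

  vertices : Graph n → List (Fin n)
  vertices G = filter (V? G) (allFin n)

  -- Every degree is less than n, so the default value n only matters when G
  -- has no vertices.
  δ : Graph n → ℕ
  δ G = min n (map (degree G) (vertices G))

  -- The values of c outside V G are irrelevant.
  IsPackingColoring : Graph n → ℕ → (Fin n → ℕ) → Set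
  IsPackingColoring G k c =
    (∀ v → v ∈ V G → 1 ≤ c v × c v ≤ k) ×
    (∀ u v → u ∈ V G → v ∈ V G → u ≢ v → c u ≡ c v → DistanceExceeds G u v (c u))

  PackingColorable : Graph n → ℕ → Set
  PackingColorable G k = ∃[ c ] IsPackingColoring G k c

  walk? : (G : Graph n) (u v : Fin n) → Decidable (Walk G u v)
  walk? G u v zero with u Fin.≟ v
  ... | yes refl = map′ nil (λ { (nil p) → p }) (V? G u)
  ... | no u≢v   = no λ { (nil _) → u≢v refl }
  walk? G u v (suc k) =
    map′ (λ (_ , a , p) → cons a p) (λ { (cons a p) → _ , a , p })
         (Fin.any? λ w → Adj? G u w ×-dec walk? G w v k)

  distanceExceeds? : (G : Graph n) (u v : Fin n) → Decidable (DistanceExceeds G u v)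
  distanceExceeds? G u v i = map′ to from (allUpTo? (¬? ∘ walk? G u v) (suc i))
    where
    to : (∀ {k} → k < suc i → ¬ Walk G u v k) → DistanceExceeds G u v i
    to none (p , _) = ≰⇒> λ d≤i → none (s≤s d≤i) p

    from : DistanceExceeds G u v i → ∀ {k} → k < suc i → ¬ Walk G u v k
    from far {k} (s≤s k≤i) p with d , isD ← least (walk? G u v) k p =
      <⇒≱ (<-≤-trans (far isD) (proj₂ isD p)) k≤i

  isPackingColoring? : (G : Graph n) (k : ℕ) → Decidable (IsPackingColoring G k)
  isPackingColoring? G k c =
    (Fin.all? λ v → V? G v →-dec ((1 ≤? c v) ×-dec (c v ≤? k)))
    ×-dec
    (Fin.all? λ u → Fin.all? λ v → V? G u →-dec V? G v →-dec ¬? (u Fin.≟ v) →-dec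
      (c u ≟ c v) →-dec distanceExceeds? G u v (c u))

  isPackingColoring-resp : (G : Graph n) {k : ℕ} {c c′ : Fin n → ℕ} →
    (∀ v → v ∈ V G → c v ≡ c′ v) → IsPackingColoring G k c → IsPackingColoring G k c′
  isPackingColoring-resp G {k} {c} {c′} eq (bounds , far) =
    (λ v v∈ → subst (λ x → 1 ≤ x × x ≤ k) (eq v v∈) (bounds v v∈)) ,
    (λ u v u∈ v∈ u≢v e → subst (DistanceExceeds G u v) (eq u u∈)
      (far u v u∈ v∈ u≢v (trans (eq u u∈) (trans e (sym (eq v v∈))))))

  packingColorable? : (G : Graph n) → Decidable (PackingColorable G)
  packingColorable? G k =
    map′ (λ (i , p) → decode i , p) from (Fin.any? (isPackingColoring? G k ∘ decode))
    where
    decode : Fin (suc k ^ n) → Fin n → ℕ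
    decode i v = toℕ (finToFun {suc k} {n} i v)

    from : PackingColorable G k → ∃[ i ] IsPackingColoring G k (decode i)
    from (c , p) = funToFin f , isPackingColoring-resp G eq p
      where
      f : Fin n → Fin (suc k)
      f v = fromℕ< (s≤s (m⊓n≤n (c v) k))

      eq : ∀ v → v ∈ V G → c v ≡ decode (funToFin f) v
      eq v v∈ = sym (trans (cong toℕ (Fin.finToFun-funToFin f v))
        (trans (Fin.toℕ-fromℕ< _) (m≤n⇒m⊓n≡m (proj₂ (proj₁ p v v∈)))))

  packingColorable-n : (G : Graph n) → PackingColorable G n
  packingColorable-n G = suc ∘ toℕ ,
    (λ v _ → s≤s z≤n , Fin.toℕ<n v) ,
    (λ u v _ _ u≢v e → contradiction (Fin.toℕ-injective (suc-injective e)) u≢v)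

  χρ-least : (G : Graph n) → ∃ (Least (PackingColorable G))
  χρ-least G = least (packingColorable? G) n (packingColorable-n G)

  χρ : Graph n → ℕ
  χρ G = proj₁ (χρ-least G)

  χρ-Critical : Graph n → Set₁
  χρ-Critical G = ∀ H → H ⊏ G → χρ H < χρ G

{-# OPTIONS --safe #-}
module Submission where

open import Defs
open import Data.Empty using (⊥; ⊥-elim)
open import Data.Fin.Base using (Fin; zero; suc)
import Data.Fin.Properties as Fin
open import Data.Fin.Subset as Subset using (Subset)
open import Data.Fin.Subset.Induction using (Acc; acc; ⊃-wellFounded)
open import Data.List.Base using (List; []; _∷_; length; map; allFin)
open import Data.List.Extrema.Nat using (min≤xs; v≤min⁺)
open import Data.List.Membership.DecPropositional using () renaming (_∈?_ to member?)
import Data.List.Membership.Propositional as List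
open import Data.List.Membership.Propositional.Properties using (∈-filter⁺; ∈-allFin)
open import Data.List.Relation.Unary.All as All using (All; []; _∷_)
open import Data.List.Relation.Unary.All.Properties using (map⁺; map⁻; all-filter)
open import Data.List.Relation.Unary.AllPairs using ([]; _∷_)
open import Data.List.Relation.Unary.Any using (here; there)
open import Data.List.Relation.Unary.Unique.Propositional using (Unique)
open import Data.List.Relation.Unary.Unique.Propositional.Properties using (filter⁺; allFin⁺)
open import Data.Nat.Base using (ℕ; zero; suc; pred; _≤_; _<_; _≥_; z≤n; s≤s; s≤s⁻¹)
open import Data.Nat.Properties using (_≟_; ≤-refl; ≤-trans; <-≤-trans; ≤-<-trans; <⇒≤; <⇒≢; <⇒≱; ≤∧≢⇒<; pred-mono-≤)
open import Data.Product.Base using (∃-syntax; Σ; _×_; _,_; proj₁; proj₂)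
open import Data.Sum.Base using (_⊎_; inj₁; inj₂)
open import Data.Vec.Base using (tabulate)
open import Data.Vec.Properties using (lookup∘tabulate; []=⇒lookup; lookup⇒[]=)
open import Function.Base using (_∘_; id; case_of_)
open import Function.Bundles using (_⇔_; mk⇔)
open import Relation.Binary.PropositionalEquality using (_≡_; _≢_; refl; sym; trans; cong; subst)
open import Relation.Nullary using (¬_; Dec; yes; no; does; contradiction)
open import Relation.Nullary.Decidable using (_×-dec_; _⊎-dec_; ¬?; decidable-stable; dec-true)
open import Relation.Unary using (Pred; _∈_; _∉_; _⊆_)

-- A block graph of diameter 2 is a windmill: cliques sharing a vertex x that is
-- adjacent to everything.  Indeed, two neighbours of x joined by a path avoiding
-- x lie on a common cycle, hence in a common block, hence are adjacent.  In such
-- a graph only color 1 can be repeated, on an independent set, so one vertex per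
-- clique saves a color.  Deleting a leaf loses a vertex but also a clique, which
-- does not lower χρ.  If there are no leaves, deleting an edge off x allows color
-- 1 twice in one clique, and deleting an edge x v moves v to distance 3 from the
-- other cliques, which allows color 2 to be used twice.

module _ {n : ℕ} where

  private variable
    G H B : Graph n
    a b p q u v w x y z : Fin n
    i j k : ℕ
    ls : List (Fin n)

  -- Walks and induced subgraphs

  Adj⇒≢ : (G : Graph n) → Adj G u v → u ≢ v
  Adj⇒≢ G e refl = irrefl G e

  Adj⇒Vʳ : (G : Graph n) → Adj G u v → v ∈ V G
  Adj⇒Vʳ G = Adj⇒V G ∘ Adj-sym G

  walk-map : H ⊑ G → Walk H u v k → Walk G u v k
  walk-map (V⊆ , _)      (nil v∈)   = nil (V⊆ v∈)
  walk-map H⊑G@(_ , E⊆) (cons e p) = cons (E⊆ e) (walk-map H⊑G p)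

  joined-map : H ⊑ G → Joined H u v → Joined G u v
  joined-map H⊑G (_ , p) = _ , walk-map H⊑G p

  joined-step : Adj G u w → Joined G w v → Joined G u v
  joined-step e (_ , p) = _ , cons e p

  joined-trans : Joined G u v → Joined G v w → Joined G u w
  joined-trans (_ , nil _)    j = j
  joined-trans (_ , cons e p) j = joined-step e (joined-trans (_ , p) j)

  adj⇒joined : (G : Graph n) → Adj G u v → Joined G u v
  adj⇒joined G e = _ , cons e (nil (Adj⇒Vʳ G e))

  joined-sym : (G : Graph n) → Joined G u v → Joined G v u
  joined-sym G (_ , nil v∈)   = _ , nil v∈
  joined-sym G (_ , cons e p) = joined-trans (joined-sym G (_ , p)) (adj⇒joined G (Adj-sym G e))

  joined⇒Vˡ : (G : Graph n) → Joined G u v → u ∈ V G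
  joined⇒Vˡ G (_ , nil u∈)   = u∈
  joined⇒Vˡ G (_ , cons e _) = Adj⇒V G e

  joined⇒Vʳ : (G : Graph n) → Joined G u v → v ∈ V G
  joined⇒Vʳ G = joined⇒Vˡ G ∘ joined-sym G

  induced : (G : Graph n) {P : Pred (Fin n) _} → (∀ v → Dec (v ∈ P)) → P ⊆ V G → Graph n
  induced G {P} P? P⊆V = record
    { V       = P
    ; Adj     = λ u v → Adj G u v × u ∈ P × v ∈ P
    ; V?      = P?
    ; Adj?    = λ u v → Adj? G u v ×-dec P? u ×-dec P? v
    ; Adj-sym = λ (e , u∈ , v∈) → Adj-sym G e , v∈ , u∈
    ; irrefl  = λ (e , _) → irrefl G e
    ; Adj⇒V   = λ (_ , u∈ , _) → u∈
    }

  deleteVertex-mono : H ⊑ G → deleteVertex H x ⊑ deleteVertex G x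
  deleteVertex-mono (V⊆ , E⊆) =
    (λ (v∈ , v≢x) → V⊆ v∈ , v≢x) , (λ (e , u≢x , v≢x) → E⊆ e , u≢x , v≢x)

  -- Blocks

  connected-spanning : H ⊑ G → V G ⊆ V H → Connected H → Connected G
  connected-spanning H⊑G V⊆ ((v , v∈) , conn) =
    (v , proj₁ H⊑G v∈) , λ u∈ v∈ → joined-map H⊑G (conn (V⊆ u∈) (V⊆ v∈))

  -- Extra edges on the same vertices cannot create a cut vertex. Connectedness of `H` supplies the
  -- walk that a cut vertex of `H` has to break.
  noCutVertex-spanning : H ⊑ G → V G ⊆ V H → Connected H → NoCutVertex H → NoCutVertex G
  noCutVertex-spanning {H = H} {G = G} H⊑G V⊆ (_ , conn) nocut x (x∈ , u , v , u≢x , v≢x , uv , cut) =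
    nocut x (V⊆ x∈ , u , v , u≢x , v≢x ,
             conn (V⊆ (joined⇒Vˡ G uv)) (V⊆ (joined⇒Vʳ G uv)) ,
             cut ∘ joined-map (deleteVertex-mono {H = H} {G = G} H⊑G))

  -- The strict superset order on `Subset n` is well-founded, which lets a subgraph be enlarged
  -- recursively until it is a block.
  vertexSubset : Graph n → Subset n
  vertexSubset G = tabulate (does ∘ V? G)

  ∈-vertexSubset⁺ : (G : Graph n) → v ∈ V G → v Subset.∈ vertexSubset G
  ∈-vertexSubset⁺ {v} G v∈ =
    lookup⇒[]= v _ (trans (lookup∘tabulate _ v) (dec-true (V? G v) v∈))

  ∈-vertexSubset⁻ : (G : Graph n) → v Subset.∈ vertexSubset G → v ∈ V G
  ∈-vertexSubset⁻ {v} G v∈ with V? G v | trans (sym (lookup∘tabulate (does ∘ V? G) v)) ([]=⇒lookup v∈)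
  ... | yes p | _  = p
  ... | no _  | ()

  ⊑-stable : ¬ ¬ (H ⊑ G) → H ⊑ G
  ⊑-stable {H} {G} ¬¬⊑ =
    (λ {v} v∈ → decidable-stable (V? G v) λ v∉ → ¬¬⊑ λ (V⊆ , _) → v∉ (V⊆ v∈)) ,
    (λ {u} {v} e → decidable-stable (Adj? G u v) λ ¬e → ¬¬⊑ λ (_ , E⊆) → ¬e (E⊆ e))

  -- Being a block quantifies over all graphs, so only the double negation is
  -- available; it suffices because adjacency is decidable.
  ¬¬block : ∀ (G B : Graph n) → Acc Subset._⊃_ (vertexSubset B) →
            B ⊑ G → Connected B → NoCutVertex B →
            ¬ ¬ (Σ (Graph n) λ B′ → IsBlock G B′ × V B ⊆ V B′)
  ¬¬block G B (acc rec) B⊑G@(V⊆ , E⊆) conn nocut none =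
    none (I , (I⊑G , connᴵ , nocutᴵ , maximal) , id)
    where
    -- Taking all edges of `G` on the vertices of `B` ensures that only a new vertex can enlarge
    -- `I`.
    I : Graph n
    I = induced G (V? B) V⊆

    B⊑I : B ⊑ I
    B⊑I = id , λ e → E⊆ e , Adj⇒V B e , Adj⇒Vʳ B e

    I⊑G : I ⊑ G
    I⊑G = V⊆ , proj₁

    connᴵ : Connected I
    connᴵ = connected-spanning B⊑I id conn

    nocutᴵ : NoCutVertex I
    nocutᴵ = noCutVertex-spanning B⊑I id conn nocut

    maximal : ∀ B′ → I ⊑ B′ → B′ ⊑ G → Connected B′ → NoCutVertex B′ → B′ ⊑ I
    maximal B′ I⊑B′ B′⊑G conn′ nocut′ = ⊑-stable {H = B′} {G = I} λ B′⋢I →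
      case (Fin.any? λ z → V? B′ z ×-dec ¬? (V? B z)) B′⋢I
      where
      case : Dec (∃[ z ] (z ∈ V B′ × z ∉ V B)) → ¬ (B′ ⊑ I) → ⊥
      -- The new vertex makes `B′` strictly larger, so a block around `B′`, and hence around `B`,
      -- comes from the recursive call.
      case (yes (z , z∈ , z∉)) _ =
        ¬¬block G B′
          (rec ((λ v∈ → ∈-vertexSubset⁺ B′ (proj₁ I⊑B′ (∈-vertexSubset⁻ B v∈))) ,
                z , ∈-vertexSubset⁺ B′ z∈ , z∉ ∘ ∈-vertexSubset⁻ B))
          B′⊑G conn′ nocut′
          λ (C , blk , ⊆C) → none (C , blk , ⊆C ∘ proj₁ I⊑B′)
      case (no ¬z) B′⋢I = B′⋢I (V′⊆ , λ e → proj₂ B′⊑G e , V′⊆ (Adj⇒V B′ e) , V′⊆ (Adj⇒Vʳ B′ e))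
        where
        V′⊆ : V B′ ⊆ V B
        V′⊆ {z} z∈ = decidable-stable (V? B z) λ z∉ → ¬z (z , z∈ , z∉)

  noCutVertex⇒adj : BlockGraph G → B ⊑ G → Connected B → NoCutVertex B →
                    u ∈ V B → v ∈ V B → u ≢ v → Adj G u v
  noCutVertex⇒adj {G} {B} {u} {v} (_ , complete) B⊑G conn nocut u∈ v∈ u≢v =
    decidable-stable (Adj? G u v) λ ¬e →
      ¬¬block G B (⊃-wellFounded _) B⊑G conn nocut
        λ (C , blk@((_ , E⊆) , _) , ⊆C) → ¬e (E⊆ (complete C blk (⊆C u∈) (⊆C v∈) u≢v))

  -- Simple paths

  -- The vertex list is an index, so that lying on a path and avoiding a vertex are both list
  -- membership.
  data Path (G : Graph n) : Fin n → Fin n → List (Fin n) → Set where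
    nil  : v ∈ V G → Path G v v (v ∷ [])
    cons : ¬ (u List.∈ ls) → Adj G u w → Path G w v ls → Path G u v (u ∷ ls)

  path-first : Path G u v ls → u List.∈ ls
  path-first (nil _)      = here refl
  path-first (cons _ _ _) = here refl

  path-last : Path G u v ls → v List.∈ ls
  path-last (nil _)      = here refl
  path-last (cons _ _ π) = there (path-last π)

  path⇒V : Path G u v ls → z List.∈ ls → z ∈ V G
  path⇒V         (nil v∈)     (here refl) = v∈
  path⇒V {G = G} (cons _ e _) (here refl) = Adj⇒V G e
  path⇒V         (cons _ _ π) (there z∈)  = path⇒V π z∈

  path-suffix : Path G u v ls → z List.∈ ls → ∃[ ls′ ] Path G z v ls′
  path-suffix π@(nil _)      (here refl) = _ , π
  path-suffix π@(cons _ _ _) (here refl) = _ , π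
  path-suffix (cons _ _ π)   (there z∈)  = path-suffix π z∈

  joined⇒path : Joined G u v → ∃[ ls ] Path G u v ls
  joined⇒path (_ , nil v∈) = _ , nil v∈
  joined⇒path {u = u} (_ , cons e p) with joined⇒path (_ , p)
  ... | ls , π with member? Fin._≟_ u ls
  -- The walk returns to `u`, so the loop is cut off.
  ...   | yes u∈ = path-suffix π u∈
  ...   | no  u∉ = _ , cons u∉ e π

  path⇒joined : Path G u v ls → z List.∈ ls → Joined G z v
  path⇒joined (nil v∈)     (here refl) = _ , nil v∈
  path⇒joined (cons _ e π) (here refl) = joined-step e (path⇒joined π (path-first π))
  path⇒joined (cons _ _ π) (there z∈)  = path⇒joined π z∈

  path-map : (∀ {a} → a List.∈ ls → a ∈ V H) →
             (∀ {a b} → a List.∈ ls → b List.∈ ls → Adj G a b → Adj H a b) →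
             Path G u v ls → Path H u v ls
  path-map V⊆ _ (nil _)       = nil (V⊆ (here refl))
  path-map V⊆ E⊆ (cons u∉ e π) =
    cons u∉ (E⊆ (here refl) (there (path-first π)) e)
         (path-map (V⊆ ∘ there) (λ a∈ b∈ → E⊆ (there a∈) (there b∈)) π)

  path-avoid : Path G u v ls → ¬ (w List.∈ ls) → Path (deleteVertex G w) u v ls
  path-avoid {ls = ls} {w = w} π w∉ =
    path-map (λ a∈ → path⇒V π a∈ , avoid a∈) (λ a∈ b∈ e → e , avoid a∈ , avoid b∈) π
    where
    avoid : a List.∈ ls → a ≢ w
    avoid a∈ refl = w∉ a∈

  -- A simple path meets `w` at most once, so the part on one side of `z` is free of `w`.
  path-split : Path G u v ls → z List.∈ ls → z ≢ w →
               Joined (deleteVertex G w) z u ⊎ Joined (deleteVertex G w) z v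
  path-split (nil v∈) (here refl) z≢w = inj₁ (_ , nil (v∈ , z≢w))
  path-split {G = G} (cons _ e _) (here refl) z≢w = inj₁ (_ , nil (Adj⇒V G e , z≢w))
  path-split {G = G} {u = u} {w = w} (cons u∉ e π) (there z∈) z≢w with u Fin.≟ w
  ... | yes refl = inj₂ (path⇒joined (path-avoid π u∉) z∈)
  ... | no u≢w with path-split π z∈ z≢w
  ...   | inj₂ zv = inj₂ zv
  ...   | inj₁ zw = inj₁ (joined-trans zw
            (adj⇒joined (deleteVertex G w)
              (Adj-sym G e , proj₂ (joined⇒Vʳ (deleteVertex G w) zw) , u≢w)))

  -- x together with a simple path from p to q avoiding x is a cycle, and hence
  -- lies in a single block.
  adj-around : BlockGraph G → Adj G x p → Adj G x q → p ≢ q →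
               Joined (deleteVertex G x) p q → Adj G p q
  adj-around {G = G} {x = x} {p = p} {q = q} blk xp xq p≢q pq with joined⇒path pq
  ... | ls , π = noCutVertex⇒adj {B = C} blk (P⊆V , proj₁) connᶜ nocutᶜ
                   (inj₂ (path-first π)) (inj₂ (path-last π)) p≢q
    where
    P : Pred (Fin n) _
    P z = z ≡ x ⊎ z List.∈ ls

    P⊆V : P ⊆ V G
    P⊆V (inj₁ refl) = Adj⇒V G xp
    P⊆V (inj₂ z∈)   = proj₁ (path⇒V π z∈)

    C : Graph n
    C = induced G (λ z → (z Fin.≟ x) ⊎-dec member? Fin._≟_ z ls) P⊆V

    πᶜ : Path C p q ls
    πᶜ = path-map inj₂ (λ a∈ b∈ (e , _) → e , inj₂ a∈ , inj₂ b∈) π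

    x∉ : ¬ (x List.∈ ls)
    x∉ x∈ = proj₂ (path⇒V π x∈) refl

    px : Adj C p x
    px = Adj-sym G xp , inj₂ (path-first π) , inj₁ refl

    qx : Adj C q x
    qx = Adj-sym G xq , inj₂ (path-last π) , inj₁ refl

    toHub : z ∈ V C → Joined C z x
    toHub (inj₁ refl) = _ , nil (inj₁ refl)
    toHub (inj₂ z∈)   = joined-trans (path⇒joined πᶜ z∈) (adj⇒joined C qx)

    connᶜ : Connected C
    connᶜ = (x , inj₁ refl) , λ u∈ v∈ → joined-trans (toHub u∈) (joined-sym C (toHub v∈))

    onPath : z ∈ V C → z ≢ x → z List.∈ ls
    onPath (inj₁ z≡x) z≢x = contradiction z≡x z≢x
    onPath (inj₂ z∈)  _   = z∈

    -- When a vertex of the path is deleted, `z` still reaches `p` or `q` along the path, and both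
    -- are neighbours of `x`.
    toHubAvoiding : x ≢ w → z ∈ V C → z ≢ w → Joined (deleteVertex C w) z x
    toHubAvoiding x≢w (inj₁ refl) _ = _ , nil (inj₁ refl , x≢w)
    toHubAvoiding {w = w} x≢w (inj₂ z∈) z≢w with path-split πᶜ z∈ z≢w
    ... | inj₁ zp = joined-trans zp
          (adj⇒joined (deleteVertex C w) (px , proj₂ (joined⇒Vʳ (deleteVertex C w) zp) , x≢w))
    ... | inj₂ zq = joined-trans zq
          (adj⇒joined (deleteVertex C w) (qx , proj₂ (joined⇒Vʳ (deleteVertex C w) zq) , x≢w))

    nocutᶜ : NoCutVertex C
    nocutᶜ w (_ , u , v , u≢w , v≢w , uv , cut) with x Fin.≟ w
    -- Deleting `x` leaves the whole path, along which everything reaches `q`.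
    ... | yes refl = cut (joined-trans (toEnd u u≢w (joined⇒Vˡ C uv))
            (joined-sym (deleteVertex C x) (toEnd v v≢w (joined⇒Vʳ C uv))))
      where
      toEnd : ∀ z → z ≢ x → z ∈ V C → Joined (deleteVertex C x) z q
      toEnd z z≢x z∈ = path⇒joined (path-avoid πᶜ x∉) (onPath z∈ z≢x)
    ... | no x≢w = cut (joined-trans (toHubAvoiding x≢w (joined⇒Vˡ C uv) u≢w)
            (joined-sym (deleteVertex C w) (toHubAvoiding x≢w (joined⇒Vʳ C uv) v≢w)))

  -- The structure of block graphs of diameter 2

  -- The field `clique` is transitivity of adjacency off the hub: without `x`, the components are
  -- cliques.
  record Windmill (G : Graph n) (x : Fin n) : Set where
    field
      hub∈   : x ∈ V G
      hub    : v ∈ V G → v ≢ x → Adj G x v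
      clique : a ≢ x → u ≢ x → b ≢ x → a ≢ b → Adj G a u → Adj G u b → Adj G a b

  open Windmill

  -- The hub is the midpoint of a walk of length 2 between vertices `p` and `q` at distance 2. A
  -- vertex not adjacent to it would join `p` to `q` around it and so make them adjacent.
  diameter₂⇒windmill : BlockGraph G → HasDiameter G 2 →
    ∃[ x ] ∃[ p ] ∃[ q ] (Windmill G x × Adj G x p × Adj G x q × p ≢ q × ¬ Adj G p q)
  diameter₂⇒windmill {G} blk (short , p , q , p∈ , q∈ , cons {w = x} px (cons xq (nil _)) , d≥2) =
    x , p , q , wm , xp , xq , p≢q , ¬pq
    where
    xp : Adj G x p
    xp = Adj-sym G px

    p≢q : p ≢ q
    p≢q refl with () ← d≥2 (nil p∈)

    ¬pq : ¬ Adj G p q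
    ¬pq e with s≤s () ← d≥2 (cons e (nil q∈))

    -- A shortest walk from `a` to `y` has length at most 2, and its middle vertex is not `x`
    -- because `y` is no neighbour of `x`.
    reach : Adj G x a → y ∈ V G → y ≢ x → ¬ Adj G x y → Joined (deleteVertex G x) a y
    reach xa y∈ y≢x ¬xy with short (Adj⇒Vʳ G xa) y∈
    ... | _ , (nil _ , _) , _ = contradiction xa ¬xy
    ... | _ , (cons ay (nil _) , _) , _ =
      adj⇒joined (deleteVertex G x) (ay , Adj⇒≢ G xa ∘ sym , y≢x)
    ... | _ , (cons az (cons zy (nil _)) , _) , _ =
      joined-step (az , Adj⇒≢ G xa ∘ sym , z≢x) (adj⇒joined (deleteVertex G x) (zy , z≢x , y≢x))
      where
      z≢x : _ ≢ x
      z≢x refl = ¬xy zy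
    ... | _ , (cons _ (cons _ (cons _ _)) , _) , s≤s (s≤s ())

    hubᴳ : v ∈ V G → v ≢ x → Adj G x v
    hubᴳ {v} v∈ v≢x = decidable-stable (Adj? G x v) λ ¬xv →
      ¬pq (adj-around blk xp xq p≢q
        (joined-trans (reach xp v∈ v≢x ¬xv)
                      (joined-sym (deleteVertex G x) (reach xq v∈ v≢x ¬xv))))

    wm : Windmill G x
    wm .hub∈ = Adj⇒V G xp
    wm .hub = hubᴳ
    wm .clique a≢x u≢x b≢x a≢b au ub =
      adj-around blk (hubᴳ (Adj⇒V G au) a≢x) (hubᴳ (Adj⇒Vʳ G ub) b≢x) a≢b
        (joined-step (au , a≢x , u≢x) (adj⇒joined (deleteVertex G x) (ub , u≢x , b≢x)))

  windmill-deleteVertex : v ≢ x → Windmill G x → Windmill (deleteVertex G v) x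
  windmill-deleteVertex v≢x wm .hub∈ = hub∈ wm , v≢x ∘ sym
  windmill-deleteVertex v≢x wm .hub (u∈ , u≢v) u≢x = hub wm u∈ u≢x , v≢x ∘ sym , u≢v
  windmill-deleteVertex v≢x wm .clique a≢x u≢x b≢x a≢b (au , a≢v , _) (ub , _ , b≢v) =
    clique wm a≢x u≢x b≢x a≢b au ub , a≢v , b≢v

  -- Packing colorings of windmills

  -- In a graph of diameter at most 2 these are exactly the packing colorings:
  -- every color other than 1 is used at most once.
  Proper : Graph n → ℕ → (Fin n → ℕ) → Set
  Proper G k c =
    (∀ v → v ∈ V G → 1 ≤ c v × c v ≤ k) ×
    (∀ {u v} → u ∈ V G → v ∈ V G → u ≢ v → c u ≡ c v → c u ≡ 1 × ¬ Adj G u v)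

  -- `DistanceExceeds` speaks of shortest walks only; the bound passes to all longer ones.
  no-short-walk : DistanceExceeds G u v i → Walk G u v k → i < k
  no-short-walk {G = G} {u = u} {v = v} {k = k} far p with d , isD ← least (walk? G u v) k p =
    <-≤-trans (far isD) (proj₂ isD p)

  nonadjacent⇒long : u ≢ v → ¬ Adj G u v → Walk G u v k → 1 < k
  nonadjacent⇒long u≢v ¬e (nil _)             = contradiction refl u≢v
  nonadjacent⇒long u≢v ¬e (cons e (nil _))    = contradiction e ¬e
  nonadjacent⇒long u≢v ¬e (cons _ (cons _ _)) = s≤s (s≤s z≤n)

  windmill-walk : Windmill G x → u ∈ V G → v ∈ V G → u ≢ v → ∃[ d ] (Walk G u v d × d ≤ 2)
  windmill-walk {G = G} {x = x} {u = u} {v = v} wm u∈ v∈ u≢v with u Fin.≟ x | v Fin.≟ x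
  ... | yes refl | yes refl = contradiction refl u≢v
  ... | yes refl | no v≢x   = 1 , cons (hub wm v∈ v≢x) (nil v∈) , s≤s z≤n
  ... | no u≢x   | yes refl = 1 , cons (Adj-sym G (hub wm u∈ u≢x)) (nil v∈) , s≤s z≤n
  ... | no u≢x   | no v≢x   =
    2 , cons (Adj-sym G (hub wm u∈ u≢x)) (cons (hub wm v∈ v≢x) (nil v∈)) , ≤-refl

  packing⇒proper : Windmill G x → ∀ {c} → IsPackingColoring G k c → Proper G k c
  packing⇒proper {G = G} wm {c} (bounds , far) = bounds , proper
    where
    proper : u ∈ V G → v ∈ V G → u ≢ v → c u ≡ c v → c u ≡ 1 × ¬ Adj G u v
    proper {u} {v} u∈ v∈ u≢v eq with windmill-walk wm u∈ v∈ u≢v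
    -- Distances are at most 2, so a repeated color is below 2; an edge would be a walk of length 1,
    -- too short even for color 1.
    ... | d , p , d≤2 = cu≡1 (proj₁ (bounds u u∈)) (<-≤-trans (no-short-walk far′ p) d≤2) , ¬uv
      where
      far′ : DistanceExceeds G u v (c u)
      far′ = far u v u∈ v∈ u≢v eq

      cu≡1 : 1 ≤ i → i < 2 → i ≡ 1
      cu≡1 {suc zero}    _ _             = refl
      cu≡1 {suc (suc _)} _ (s≤s (s≤s ()))

      ¬uv : ¬ Adj G u v
      ¬uv e = <⇒≱ (no-short-walk far′ (cons e (nil v∈))) (proj₁ (bounds u u∈))

  proper⇒packing : ∀ {c} → Proper G k c → IsPackingColoring G k c
  proper⇒packing {G = G} (bounds , proper) = bounds , λ u v u∈ v∈ u≢v eq (p , _) →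
    let cu≡1 , ¬uv = proper u∈ v∈ u≢v eq
    in subst (_< _) (sym cu≡1) (nonadjacent⇒long u≢v ¬uv p)

  module _ (G : Graph n) (c : Fin n → ℕ) (u : Fin n) where

    -- At most one neighbour of u has color 1, so this is an exchange of colors, or
    -- a recoloring of u alone if there is none.
    mark : Fin n → ℕ
    mark z with z Fin.≟ u
    ... | yes _ = 1
    ... | no _ with Adj? G u z ×-dec (c z ≟ 1)
    ...   | yes _ = c u
    ...   | no _  = c z

    -- The index is the resulting color, so one match replaces the nested tests in `mark`.
    data MarkView (z : Fin n) : ℕ → Set where
      self      : z ≡ u → MarkView z 1
      neighbour : z ≢ u → Adj G u z → c z ≡ 1 → MarkView z (c u)
      other     : z ≢ u → ¬ (Adj G u z × c z ≡ 1) → MarkView z (c z)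

    markView : ∀ z → MarkView z (mark z)
    markView z with z Fin.≟ u
    ... | yes z≡u = self z≡u
    ... | no z≢u with Adj? G u z ×-dec (c z ≟ 1)
    ...   | yes (e , cz≡1) = neighbour z≢u e cz≡1
    ...   | no ¬p          = other z≢u ¬p

    mark-self : mark u ≡ 1
    mark-self with mark u | markView u
    ... | _ | self _            = refl
    ... | _ | neighbour u≢u _ _ = contradiction refl u≢u
    ... | _ | other u≢u _       = contradiction refl u≢u

    mark-far : z ≢ u → ¬ Adj G u z → mark z ≡ c z
    mark-far {z} z≢u ¬e with mark z | markView z
    ... | _ | self z≡u        = contradiction z≡u z≢u
    ... | _ | neighbour _ e _ = contradiction e ¬e
    ... | _ | other _ _       = refl

    module _ (wm : Windmill G x) (col : Proper G k c) (u∈ : u ∈ V G) (u≢x : u ≢ x) where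

      ones-apart : Adj G a b → c a ≡ 1 → c b ≢ 1
      ones-apart e ca cb = proj₂ (proj₂ col (Adj⇒V G e) (Adj⇒Vʳ G e) (Adj⇒≢ G e) (trans ca (sym cb))) e

      -- The hub is adjacent to `u`. If it has color 1, it receives the old color of `u`, which is
      -- then not 1.
      mark-hub : mark x ≢ 1
      mark-hub with mark x | markView x
      ... | _ | self x≡u         = λ _ → u≢x (sym x≡u)
      ... | _ | neighbour _ e cx = λ cu → ones-apart e cu cx
      ... | _ | other _ ¬p       = λ cx → ¬p (Adj-sym G (hub wm u∈ u≢x) , cx)

      -- The neighbours of `u` are the hub and the rest of its clique, hence pairwise adjacent.
      one-neighbour : Adj G u a → Adj G u b → c a ≡ 1 → c b ≡ 1 → a ≡ b
      one-neighbour {a} {b} ua ub ca cb with a Fin.≟ b | a Fin.≟ x | b Fin.≟ x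
      ... | yes a≡b | _ | _ = a≡b
      ... | no a≢b | yes refl | _ =
        contradiction cb (ones-apart (hub wm (Adj⇒Vʳ G ub) (a≢b ∘ sym)) ca)
      ... | no a≢b | no _ | yes refl =
        contradiction ca (ones-apart (hub wm (Adj⇒Vʳ G ua) a≢b) cb)
      ... | no a≢b | no a≢x | no b≢x =
        contradiction cb (ones-apart (clique wm a≢x u≢x b≢x a≢b (Adj-sym G ua) ub) ca)

      mark-proper : Proper G k mark
      mark-proper = bounds , proper
        where
        bounds : ∀ z → z ∈ V G → 1 ≤ mark z × mark z ≤ k
        bounds z z∈ with mark z | markView z
        ... | _ | self _          = let 1≤ , ≤k = proj₁ col u u∈ in ≤-refl , ≤-trans 1≤ ≤k
        ... | _ | neighbour _ _ _ = proj₁ col u u∈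
        ... | _ | other _ _       = proj₁ col z z∈

        proper : a ∈ V G → b ∈ V G → a ≢ b → mark a ≡ mark b → mark a ≡ 1 × ¬ Adj G a b
        proper {a} {b} a∈ b∈ a≢b eq with mark a | markView a | mark b | markView b
        ... | _ | self refl | _ | self refl = contradiction refl a≢b
        ... | _ | self refl | _ | neighbour _ e cb = contradiction cb (ones-apart e (sym eq))
        ... | _ | self refl | _ | other _ ¬p = refl , λ e → ¬p (e , sym eq)
        ... | _ | neighbour _ e ca | _ | self refl = contradiction ca (ones-apart e eq)
        ... | _ | neighbour _ e ca | _ | neighbour _ e′ cb = contradiction (one-neighbour e e′ ca cb) a≢b
        -- Since `b` and `u` share a color, that color is 1, but `u` has the neighbour `a` of color
        -- 1.
        ... | _ | neighbour _ e ca | _ | other b≢u _ =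
          contradiction ca (ones-apart e (proj₁ (proj₂ col u∈ b∈ (b≢u ∘ sym) eq)))
        ... | _ | other _ ¬p | _ | self refl = eq , λ e → ¬p (Adj-sym G e , eq)
        ... | _ | other a≢u _ | _ | neighbour _ e cb =
          contradiction cb (ones-apart e (trans (sym eq) (proj₁ (proj₂ col a∈ u∈ a≢u eq))))
        ... | _ | other _ _ | _ | other _ _ = proj₂ col a∈ b∈ a≢b eq

  -- Deleting a leaf

  _[_≔_] : (Fin n → ℕ) → Fin n → ℕ → Fin n → ℕ
  (c [ v ≔ t ]) z with z Fin.≟ v
  ... | yes _ = t
  ... | no _  = c z

  χρ-minimal : PackingColorable G k → χρ G ≤ k
  χρ-minimal {G = G} = proj₂ (proj₂ (χρ-least G))

  -- An optimal coloring of the graph without `v` extends at no cost: marking `y` frees the hub, the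
  -- only neighbour of `v`, from color 1, which `v` then takes.
  leaf⇒¬critical : Windmill G x → v ∈ V G → v ≢ x → (∀ {z} → Adj G v z → z ≡ x) →
                   y ∈ V G → y ≢ x → y ≢ v → ¬ χρ-Critical G
  leaf⇒¬critical {G = G} {x = x} {v = v} {y = y} wm v∈ v≢x leaf y∈ y≢x y≢v critical =
    <⇒≱ (critical K K⊏G) (χρ-minimal {G = G} (c″ , proper⇒packing {G = G} (bounds , proper)))
    where
    K : Graph n
    K = deleteVertex G v

    K⊏G : K ⊏ G
    K⊏G = (proj₁ , proj₁) , λ (V⊆ , _) → proj₂ (V⊆ v∈) refl

    wmᴷ : Windmill K x
    wmᴷ = windmill-deleteVertex v≢x wm

    m : ℕ
    m = χρ K

    c : Fin n → ℕ
    c = proj₁ (proj₁ (proj₂ (χρ-least K)))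

    col : Proper K m c
    col = packing⇒proper wmᴷ (proj₂ (proj₁ (proj₂ (χρ-least K))))

    c′ c″ : Fin n → ℕ
    c′ = mark K c y
    c″ = c′ [ v ≔ 1 ]

    col′ : Proper K m c′
    col′ = mark-proper K c y wmᴷ col (y∈ , y≢v) y≢x

    ¬adj-one : c′ z ≡ 1 → ¬ Adj G v z
    ¬adj-one cz e with refl ← leaf e = mark-hub K c y wmᴷ col (y∈ , y≢v) y≢x cz

    bounds : ∀ z → z ∈ V G → 1 ≤ c″ z × c″ z ≤ m
    bounds z z∈ with z Fin.≟ v
    -- The color of the hub witnesses that `m` is at least 1.
    ... | yes _ = let 1≤ , ≤m = proj₁ col x (hub∈ wmᴷ) in ≤-refl , ≤-trans 1≤ ≤m
    ... | no z≢v = proj₁ col′ z (z∈ , z≢v)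

    proper : a ∈ V G → b ∈ V G → a ≢ b → c″ a ≡ c″ b → c″ a ≡ 1 × ¬ Adj G a b
    proper {a} {b} a∈ b∈ a≢b eq with a Fin.≟ v | b Fin.≟ v
    ... | yes refl | yes refl = contradiction refl a≢b
    ... | yes refl | no _     = refl , ¬adj-one (sym eq)
    ... | no _     | yes refl = eq , ¬adj-one eq ∘ Adj-sym G
    ... | no a≢v   | no b≢v   = let ca , ¬e = proj₂ col′ (a∈ , a≢v) (b∈ , b≢v) a≢b eq
                                in ca , λ e → ¬e (e , a≢v , b≢v)

-- Exchanging two colors

swap : ℕ → ℕ → ℕ → ℕ
swap i j m with m ≟ i
... | yes _ = j
... | no _ with m ≟ j
...   | yes _ = i
...   | no _  = m

swap-left : ∀ i j → swap i j i ≡ j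
swap-left i j with i ≟ i
... | yes _  = refl
... | no i≢i = contradiction refl i≢i

swap-fixed : ∀ i j {m} → m ≢ i → m ≢ j → swap i j m ≡ m
swap-fixed i j {m} m≢i m≢j with m ≟ i
... | yes m≡i = contradiction m≡i m≢i
... | no _ with m ≟ j
...   | yes m≡j = contradiction m≡j m≢j
...   | no _    = refl

swap-involutive : ∀ i j m → swap i j (swap i j m) ≡ m
swap-involutive i j m with m ≟ i
... | yes refl with j ≟ i
...   | yes refl = refl
...   | no _ with j ≟ j
...     | yes _  = refl
...     | no j≢j = contradiction refl j≢j
swap-involutive i j m | no m≢i with m ≟ j
...   | yes refl = swap-left i j
...   | no m≢j   = swap-fixed i j m≢i m≢j

swap-injective : ∀ i j {l m} → swap i j l ≡ swap i j m → l ≡ m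
swap-injective i j {l} {m} eq =
  trans (sym (swap-involutive i j l)) (trans (cong (swap i j) eq) (swap-involutive i j m))

swap-preserves : ∀ {P : ℕ → Set} {i j m} → P i → P j → P m → P (swap i j m)
swap-preserves {i = i} {j} {m} pi pj pm with m ≟ i
... | yes _ = pj
... | no _ with m ≟ j
...   | yes _ = pi
...   | no _  = pm

module _ {n : ℕ} where

  private variable
    G H : Graph n
    a b p q u v x z : Fin n
    i j k : ℕ

  open Windmill

  -- The colors other than 1 all obey the same rule, one vertex each, so they are interchangeable.
  swap-proper : ∀ {c} → i ≢ 1 → j ≢ 1 → 1 ≤ i × i ≤ k → 1 ≤ j × j ≤ k →
                Proper G k c → Proper G k (swap i j ∘ c)
  swap-proper {i} {j} {k} i≢1 j≢1 i∈ j∈ (bounds , proper) =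
    (λ v v∈ → swap-preserves {P = λ m → 1 ≤ m × m ≤ k} i∈ j∈ (bounds v v∈)) ,
    λ u∈ v∈ u≢v eq → let cu , ¬e = proper u∈ v∈ u≢v (swap-injective i j eq)
                     in trans (cong (swap i j) cu) (swap-fixed i j (i≢1 ∘ sym) (j≢1 ∘ sym)) , ¬e

  swap-≢1 : ∀ {m} → i ≢ 1 → j ≢ 1 → m ≢ 1 → swap i j m ≢ 1
  swap-≢1 = swap-preserves {P = _≢ 1}

  ≢1⇒2≤ : 1 ≤ i → i ≢ 1 → 2 ≤ i
  ≢1⇒2≤ 1≤i i≢1 = ≤∧≢⇒< 1≤i (i≢1 ∘ sym)

  2≤⇒≢1 : 2 ≤ i → i ≢ 1
  2≤⇒≢1 (s≤s ()) refl

  -- A color other than 1 occurs only once, so `v` alone has color `k`. Recoloring `v` then saves a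
  -- color.
  top-unused : ∀ {c} → Proper G k c → v ∈ V G → c v ≡ k → k ≢ 1 →
               z ∈ V G → z ≢ v → c z ≤ pred k
  top-unused {k = zero} {z = z} (bounds , _) _ _ _ z∈ _ = proj₂ (bounds z z∈)
  top-unused {k = suc _} {z = z} (bounds , proper) v∈ cv k≢1 z∈ z≢v =
    s≤s⁻¹ (≤∧≢⇒< (proj₂ (bounds z z∈)) λ cz →
      k≢1 (trans (sym cz) (proj₁ (proper z∈ v∈ z≢v (trans cz (sym cv))))))

  -- Saving a color when an edge is missing

  Improves : Graph n → Graph n → Set
  Improves H G = ∀ {k} → PackingColorable G k → ∃[ l ] (l < k × PackingColorable H l)

  2≤⇒pred< : 2 ≤ k → pred k < k
  2≤⇒pred< (s≤s _) = ≤-refl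

  -- The color of v is moved to k, and then v can share color 1 with u.
  drop-rim-edge : Windmill G x → H ⊑ G → u ≢ x → v ≢ x → Adj G u v → ¬ Adj H u v → Improves H G
  drop-rim-edge {G = G} {x = x} {H = H} {u = u} {v = v} wm (V⊆ , E⊆) u≢x v≢x uv ¬uv {k} (c₀ , col₀) =
    pred k , 2≤⇒pred< 2≤k , c₃ , proper⇒packing {G = H} (bounds , proper)
    where
    u∈ : u ∈ V G
    u∈ = Adj⇒V G uv

    v∈ : v ∈ V G
    v∈ = Adj⇒Vʳ G uv

    proper₀ : Proper G k c₀
    proper₀ = packing⇒proper wm col₀

    -- Marking `u` keeps color 1 away from `v` and from the hub.
    c₁ : Fin n → ℕ
    c₁ = mark G c₀ u

    proper₁ : Proper G k c₁
    proper₁ = mark-proper G c₀ u wm proper₀ u∈ u≢x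

    c₁v≢1 : c₁ v ≢ 1
    c₁v≢1 = ones-apart G c₁ u wm proper₁ u∈ u≢x uv (mark-self G c₀ u)

    v-bounds : 1 ≤ c₁ v × c₁ v ≤ k
    v-bounds = proj₁ proper₁ v v∈

    2≤k : 2 ≤ k
    2≤k = ≤-trans (≢1⇒2≤ (proj₁ v-bounds) c₁v≢1) (proj₂ v-bounds)

    k≢1 : k ≢ 1
    k≢1 = 2≤⇒≢1 2≤k

    c₂ c₃ : Fin n → ℕ
    c₂ = swap (c₁ v) k ∘ c₁
    c₃ = c₂ [ v ≔ 1 ]

    proper₂ : Proper G k c₂
    proper₂ = swap-proper {G = G} c₁v≢1 k≢1 v-bounds (≤-trans (s≤s z≤n) 2≤k , ≤-refl) proper₁

    c₂u : c₂ u ≡ 1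
    c₂u = trans (cong (swap (c₁ v) k) (mark-self G c₀ u)) (swap-fixed _ _ (c₁v≢1 ∘ sym) (k≢1 ∘ sym))

    c₂x≢1 : c₂ x ≢ 1
    c₂x≢1 = swap-≢1 c₁v≢1 k≢1 (mark-hub G c₀ u wm proper₀ u∈ u≢x)

    ¬adj-one : c₂ z ≡ 1 → ¬ Adj H v z
    ¬adj-one {z} cz vz = case z Fin.≟ u of λ where
      (yes refl) → ¬uv (Adj-sym H vz)
      -- Here `z` has color 1, so it is not the hub; it lies in the clique of `u` and `v` and is
      -- adjacent to `u`, also of color 1.
      (no z≢u)   → ones-apart G c₂ u wm proper₂ u∈ u≢x
        (clique wm u≢x v≢x (λ { refl → c₂x≢1 cz }) (z≢u ∘ sym) uv (E⊆ vz)) c₂u cz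

    bounds : ∀ z → z ∈ V H → 1 ≤ c₃ z × c₃ z ≤ pred k
    bounds z z∈ with z Fin.≟ v
    ... | yes _  = ≤-refl , pred-mono-≤ 2≤k
    ... | no z≢v = proj₁ (proj₁ proper₂ z (V⊆ z∈)) ,
                   top-unused {G = G} proper₂ v∈ (swap-left (c₁ v) k) k≢1 (V⊆ z∈) z≢v

    proper : a ∈ V H → b ∈ V H → a ≢ b → c₃ a ≡ c₃ b → c₃ a ≡ 1 × ¬ Adj H a b
    proper {a} {b} a∈ b∈ a≢b eq with a Fin.≟ v | b Fin.≟ v
    ... | yes refl | yes refl = contradiction refl a≢b
    ... | yes refl | no _     = refl , ¬adj-one (sym eq)
    ... | no _     | yes refl = eq , ¬adj-one eq ∘ Adj-sym H
    ... | no _     | no _     = let ca , ¬e = proj₂ proper₂ (V⊆ a∈) (V⊆ b∈) a≢b eq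
                                in ca , ¬e ∘ E⊆

  -- Without the edge x v, the vertices v and v′ are at distance at least 3, so
  -- both can have color 2, provided neither is needed for color 1; hence the
  -- neighbours w and w′.
  drop-spoke : Windmill G x → H ⊑ G → ¬ Adj H x v →
               ∀ {v′ w w′} → v ≢ x → v′ ≢ x → v ≢ v′ → ¬ Adj G v v′ →
               Adj G v w → w ≢ x → Adj G v′ w′ → w′ ≢ x → Improves H G
  drop-spoke {G = G} {x = x} {H = H} {v = v} wm (V⊆ , E⊆) ¬xv {v′} {w} {w′}
             v≢x v′≢x v≢v′ ¬vv′ vw w≢x v′w′ w′≢x {k} (c₀ , col₀) =
    pred k , 2≤⇒pred< (<⇒≤ 3≤k) , c₅ , bounds , far
    where
    v∈ : v ∈ V G
    v∈ = Adj⇒V G vw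

    v′∈ : v′ ∈ V G
    v′∈ = Adj⇒V G v′w′

    w∈ : w ∈ V G
    w∈ = Adj⇒Vʳ G vw

    w′∈ : w′ ∈ V G
    w′∈ = Adj⇒Vʳ G v′w′

    -- The vertices `v` and `v′` lie in different cliques, hence so do `w` and `w′`, and marking
    -- `w′` leaves the color of `w` alone.
    w≢v′ : w ≢ v′
    w≢v′ refl = ¬vv′ vw

    ¬v′w : ¬ Adj G v′ w
    ¬v′w e = ¬vv′ (clique wm v≢x w≢x v′≢x v≢v′ vw (Adj-sym G e))

    w≢w′ : w ≢ w′
    w≢w′ refl = ¬v′w v′w′

    ¬w′w : ¬ Adj G w′ w
    ¬w′w e = ¬v′w (clique wm v′≢x w′≢x w≢x (w≢v′ ∘ sym) v′w′ e)

    proper₀ : Proper G k c₀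
    proper₀ = packing⇒proper wm col₀

    c₁ c₂ : Fin n → ℕ
    c₁ = mark G c₀ w
    c₂ = mark G c₁ w′

    proper₁ : Proper G k c₁
    proper₁ = mark-proper G c₀ w wm proper₀ w∈ w≢x

    proper₂ : Proper G k c₂
    proper₂ = mark-proper G c₁ w′ wm proper₁ w′∈ w′≢x

    c₂v≢1 : c₂ v ≢ 1
    c₂v≢1 = ones-apart G c₂ w wm proper₂ w∈ w≢x (Adj-sym G vw)
      (trans (mark-far G c₁ w′ w≢w′ ¬w′w) (mark-self G c₀ w))

    c₂v′≢1 : c₂ v′ ≢ 1
    c₂v′≢1 = ones-apart G c₂ w′ wm proper₂ w′∈ w′≢x (Adj-sym G v′w′) (mark-self G c₁ w′)

    v-bounds : 1 ≤ c₂ v × c₂ v ≤ k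
    v-bounds = proj₁ proper₂ v v∈

    2≤k : 2 ≤ k
    2≤k = ≤-trans (≢1⇒2≤ (proj₁ v-bounds) c₂v≢1) (proj₂ v-bounds)

    k≢1 : k ≢ 1
    k≢1 = 2≤⇒≢1 2≤k

    -- First `v` gets color 2, then `v′` the top color `k`, which it finally gives up for 2.
    c₃ c₄ c₅ : Fin n → ℕ
    c₃ = swap (c₂ v) 2 ∘ c₂
    c₄ = swap (c₃ v′) k ∘ c₃
    c₅ = c₄ [ v′ ≔ 2 ]

    proper₃ : Proper G k c₃
    proper₃ = swap-proper {G = G} c₂v≢1 (λ ()) v-bounds (s≤s z≤n , 2≤k) proper₂

    c₃v : c₃ v ≡ 2
    c₃v = swap-left (c₂ v) 2

    c₃v′≢1 : c₃ v′ ≢ 1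
    c₃v′≢1 = swap-≢1 c₂v≢1 (λ ()) c₂v′≢1

    c₃v′≢2 : c₃ v′ ≢ 2
    c₃v′≢2 eq = c₃v′≢1 (proj₁ (proj₂ proper₃ v′∈ v∈ (v≢v′ ∘ sym) (trans eq (sym c₃v))))

    v′-bounds : 1 ≤ c₃ v′ × c₃ v′ ≤ k
    v′-bounds = proj₁ proper₃ v′ v′∈

    -- The color of `v′` is neither 1 nor 2. So `k` is not 2, and the exchange with `k` leaves `v`
    -- at color 2.
    3≤k : 3 ≤ k
    3≤k = ≤-trans (≤∧≢⇒< (≢1⇒2≤ (proj₁ v′-bounds) c₃v′≢1) (c₃v′≢2 ∘ sym)) (proj₂ v′-bounds)

    proper₄ : Proper G k c₄
    proper₄ = swap-proper {G = G} c₃v′≢1 k≢1 v′-bounds (≤-trans (s≤s z≤n) 2≤k , ≤-refl) proper₃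

    c₄v : c₄ v ≡ 2
    c₄v = trans (cong (swap (c₃ v′) k) c₃v) (swap-fixed _ _ (c₃v′≢2 ∘ sym) (<⇒≢ 3≤k))

    two⇒v : z ∈ V H → c₄ z ≡ 2 → z ≡ v
    two⇒v {z} z∈ cz with z Fin.≟ v
    ... | yes z≡v = z≡v
    ... | no z≢v with () ← trans (sym cz) (proj₁ (proj₂ proper₄ (V⊆ z∈) v∈ z≢v (trans cz (sym c₄v))))

    -- The hub is ruled out by the missing edge; any other common neighbour would put `v` and `v′`
    -- into one clique.
    no-common-neighbour : Adj H v z → ¬ Adj H z v′
    no-common-neighbour {z} vz zv′ with z Fin.≟ x
    ... | yes refl = ¬xv (Adj-sym H vz)
    ... | no z≢x   = ¬vv′ (clique wm v≢x z≢x v′≢x v≢v′ (E⊆ vz) (E⊆ zv′))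

    vv′-far : ∀ {d} → Walk H v v′ d → 2 < d
    vv′-far (nil _)                      = contradiction refl v≢v′
    vv′-far (cons e (nil _))             = contradiction (E⊆ e) ¬vv′
    vv′-far (cons e (cons e′ (nil _)))   = contradiction e′ (no-common-neighbour e)
    vv′-far (cons _ (cons _ (cons _ _))) = s≤s (s≤s (s≤s z≤n))

    v′v-far : ∀ {d} → Walk H v′ v d → 2 < d
    v′v-far (nil _)                      = contradiction refl v≢v′
    v′v-far (cons e (nil _))             = contradiction (Adj-sym G (E⊆ e)) ¬vv′
    v′v-far (cons e (cons e′ (nil _)))   =
      contradiction (Adj-sym H e) (no-common-neighbour (Adj-sym H e′))
    v′v-far (cons _ (cons _ (cons _ _))) = s≤s (s≤s (s≤s z≤n))

    bounds : ∀ z → z ∈ V H → 1 ≤ c₅ z × c₅ z ≤ pred k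
    bounds z z∈ with z Fin.≟ v′
    ... | yes _   = s≤s z≤n , pred-mono-≤ 3≤k
    ... | no z≢v′ = proj₁ (proj₁ proper₄ z (V⊆ z∈)) ,
                    top-unused {G = G} proper₄ v′∈ (swap-left (c₃ v′) k) k≢1 (V⊆ z∈) z≢v′

    -- Color 2 may occur at both `v` and `v′`, so `c₅` need not be `Proper` and the distances are
    -- bounded directly.
    far : ∀ a b → a ∈ V H → b ∈ V H → a ≢ b → c₅ a ≡ c₅ b → DistanceExceeds H a b (c₅ a)
    far a b a∈ b∈ a≢b eq (π , _) with a Fin.≟ v′ | b Fin.≟ v′
    ... | yes refl | yes refl = contradiction refl a≢b
    ... | yes refl | no _ with refl ← two⇒v b∈ (sym eq) = v′v-far π
    ... | no _ | yes refl with refl ← two⇒v a∈ eq = subst (_< _) (sym eq) (vv′-far π)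
    ... | no _ | no _ = let ca , ¬e = proj₂ proper₄ (V⊆ a∈) (V⊆ b∈) a≢b eq
                        in subst (_< _) (sym ca) (nonadjacent⇒long a≢b (¬e ∘ E⊆) π)

  -- Degrees

  2≤length : ∀ {A : Set} {x y : A} {xs : List A} → x List.∈ xs → y List.∈ xs → x ≢ y → 2 ≤ length xs
  2≤length (here refl) (here refl)         x≢y = contradiction refl x≢y
  2≤length {xs = _ ∷ _ ∷ _} (here _) (there _) _ = s≤s (s≤s z≤n)
  2≤length {xs = _ ∷ _ ∷ _} (there _) _        _ = s≤s (s≤s z≤n)

  2≤degree : (G : Graph n) → Adj G v a → Adj G v b → a ≢ b → 2 ≤ degree G v
  2≤degree {v} G va vb =
    2≤length (∈-filter⁺ (Adj? G v) (∈-allFin _) va) (∈-filter⁺ (Adj? G v) (∈-allFin _) vb)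

  -- The list of neighbours has no repetitions, so `x` is at most one of its first two entries.
  another-neighbour : (G : Graph n) → 2 ≤ degree G v → ∀ x → ∃[ w ] (Adj G v w × w ≢ x)
  another-neighbour {v} G 2≤ x = go _ (all-filter (Adj? G v) (allFin n)) (filter⁺ (Adj? G v) (allFin⁺ n)) 2≤
    where
    go : ∀ xs → All (Adj G v) xs → Unique xs → 2 ≤ length xs → ∃[ w ] (Adj G v w × w ≢ x)
    go (_ ∷ []) _ _ (s≤s ())
    go (a ∷ b ∷ _) (va ∷ vb ∷ _) ((a≢b ∷ _) ∷ _) _ with a Fin.≟ x
    ... | yes refl = b , vb , a≢b ∘ sym
    ... | no a≢x   = a , va , a≢x

  δ≤degree : (G : Graph n) → v ∈ V G → δ G ≤ degree G v
  δ≤degree {v} G v∈ = All.lookup (map⁻ (min≤xs n (map (degree G) (vertices G))))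
                        (∈-filter⁺ (V? G) (∈-allFin v) v∈)

  -- The bound `k ≤ n` accounts for the default value `n` of the minimum in `δ`.
  ≤δ : (G : Graph n) → k ≤ n → (∀ {v} → v ∈ V G → k ≤ degree G v) → k ≤ δ G
  ≤δ G k≤n k≤deg = v≤min⁺ k≤n (map⁺ (All.map k≤deg (all-filter (V? G) (allFin n))))

  ≢⇒2≤n : {a b : Fin n} → a ≢ b → 2 ≤ n
  ≢⇒2≤n = 2≤m
    where
    -- The module parameter `n` is generalized to `m` to allow matching on it.
    2≤m : ∀ {m} {a b : Fin m} → a ≢ b → 2 ≤ m
    2≤m {suc zero} {zero} {zero} a≢b = contradiction refl a≢b
    2≤m {suc (suc _)} _ = s≤s (s≤s z≤n)

  -- The two implications

  critical⇒δ≥2 : Windmill G x → Adj G x p → Adj G x q → p ≢ q → χρ-Critical G → 2 ≤ δ G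
  critical⇒δ≥2 {G = G} {x = x} {p = p} {q = q} wm xp xq p≢q critical = ≤δ G (≢⇒2≤n p≢q) deg
    where
    other-rim : ∀ v → ∃[ y ] (Adj G x y × y ≢ v)
    other-rim v with p Fin.≟ v
    ... | yes refl = q , xq , p≢q ∘ sym
    ... | no p≢v   = p , xp , p≢v

    deg : v ∈ V G → 2 ≤ degree G v
    deg {v} v∈ with v Fin.≟ x
    ... | yes refl = 2≤degree G xp xq p≢q
    ... | no v≢x with Fin.any? (λ z → Adj? G v z ×-dec ¬? (z Fin.≟ x))
    ...   | yes (z , vz , z≢x) = 2≤degree G vz (Adj-sym G (hub wm v∈ v≢x)) z≢x
    -- Here `v` is a leaf; `p` or `q` serves as the other rim vertex.
    ...   | no ¬z = let y , xy , y≢v = other-rim v in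
      contradiction critical (leaf⇒¬critical wm v∈ v≢x
        (λ {z} vz → decidable-stable (z Fin.≟ x) λ z≢x → ¬z (z , vz , z≢x))
        (Adj⇒Vʳ G xy) (Adj⇒≢ G xy ∘ sym) y≢v)

  -- Every vertex of `G` lies on an edge, so a subgraph with all the edges has all the vertices.
  -- Deleted vertices are thus covered by deleted edges.
  missing-edge : (∀ {v} → v ∈ V G → ∃[ w ] Adj G v w) → H ⊏ G →
                 ∃[ u ] ∃[ v ] (Adj G u v × ¬ Adj H u v)
  missing-edge {G = G} {H = H} nbr (_ , G⋢H)
    with Fin.any? (λ u → Fin.any? λ v → Adj? G u v ×-dec ¬? (Adj? H u v))
  ... | yes found = found
  ... | no none   = ⊥-elim (G⋢H ((λ v∈ → Adj⇒V H (E⊆ (proj₂ (nbr v∈)))) , E⊆))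
    where
    E⊆ : Adj G u v → Adj H u v
    E⊆ {u} {v} e = decidable-stable (Adj? H u v) λ ¬e → none (u , v , e , ¬e)

  improves⇒χρ< : Improves H G → χρ H < χρ G
  improves⇒χρ< {H = H} {G = G} improve =
    let l , l< , col = improve (proj₁ (proj₂ (χρ-least G)))
    in ≤-<-trans (χρ-minimal {G = H} col) l<

  δ≥2⇒critical : Windmill G x → Adj G x p → Adj G x q → p ≢ q → ¬ Adj G p q →
                 2 ≤ δ G → χρ-Critical G
  δ≥2⇒critical {G = G} {x = x} {p = p} {q = q} wm xp xq p≢q ¬pq 2≤δ H H⊏G@(H⊑G , _) =
    improves⇒χρ< {H = H} {G = G} improve
    where
    rim-neighbour : v ∈ V G → ∃[ w ] (Adj G v w × w ≢ x)
    rim-neighbour v∈ = another-neighbour G (≤-trans 2≤δ (δ≤degree G v∈)) x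

    -- Since `p` and `q` lie in different cliques, at least one of them is outside the clique of
    -- `v`.
    stranger : ∀ v → v ≢ x → ∃[ v′ ] (Adj G x v′ × v ≢ v′ × ¬ Adj G v v′)
    stranger v v≢x with v Fin.≟ p | Adj? G v p
    ... | yes refl | _     = q , xq , p≢q , ¬pq
    ... | no v≢p   | no ¬e = p , xp , v≢p , ¬e
    ... | no _     | yes e = q , xq , (λ { refl → ¬pq (Adj-sym G e) }) ,
      λ e′ → ¬pq (clique wm (Adj⇒≢ G xp ∘ sym) v≢x (Adj⇒≢ G xq ∘ sym) p≢q (Adj-sym G e) e′)

    spoke : Adj G x v → ¬ Adj H x v → Improves H G
    spoke {v} xv ¬xv =
      let v≢x                   = Adj⇒≢ G xv ∘ sym
          v′ , xv′ , v≢v′ , ¬vv′ = stranger v v≢x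
          w , vw , w≢x           = rim-neighbour (Adj⇒Vʳ G xv)
          w′ , v′w′ , w′≢x       = rim-neighbour (Adj⇒Vʳ G xv′)
      in drop-spoke {H = H} wm H⊑G ¬xv v≢x (Adj⇒≢ G xv′ ∘ sym) v≢v′ ¬vv′ vw w≢x v′w′ w′≢x

    improve : Improves H G
    improve with missing-edge {G = G} {H = H} (λ v∈ → let w , vw , _ = rim-neighbour v∈ in w , vw) H⊏G
    ... | u , v , uv , ¬uv with u Fin.≟ x | v Fin.≟ x
    ...   | yes refl | _        = spoke uv ¬uv
    ...   | no _     | yes refl = spoke (Adj-sym G uv) (¬uv ∘ Adj-sym H)
    ...   | no u≢x   | no v≢x   = drop-rim-edge {H = H} wm H⊑G u≢x v≢x uv ¬uv

theorem5p1 : ∀ (n : ℕ) (G : Graph n) → BlockGraph G → HasDiameter G 2 → χρ-Critical G ⇔ δ G ≥ 2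
theorem5p1 n G blk diam =
  let x , p , q , wm , xp , xq , p≢q , ¬pq = diameter₂⇒windmill blk diam
  in mk⇔ (critical⇒δ≥2 wm xp xq p≢q) (δ≥2⇒critical wm xp xq p≢q ¬pq)
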